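{- For every integer $a\ge 2$ and every real number $b\in(1,a)$ there exist an integer $N$ and an infinite sequence $\omega$ over an $a$-letter alphabet such that for every $n\ge N$, any two different occurrences in $\omega$ of the same substring (factor) of length $n$ are at distance at least $b^n$ from each other.
   Context: An occurrence of a string $u$ of length $n$ in $\omega=\omega_0\omega_1\ldots$ is a position $i$ with $\omega_i\omega_{i+1}\cdots\omega_{i+n-1}=u$; the distance between occurrences at positions $i$ and $j$ is $|i-j|$. -}

module Defs where

open import Data.Nat using (ℕ; zero; suc; _+_; _<_)
open import Data.Fin using (Fin)
open import Data.Integer using (+_)
open import Data.Rational using (ℚ; 1ℚ; _*_; _/_)
open import Relation.Binary.PropositionalEquality using (_≡_)

ℕ→ℚ : ℕ → ℚ
ℕ→ℚ k = (+ k) / 1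

_^ℚ_ : ℚ → ℕ → ℚ
b ^ℚ zero  = 1ℚ
b ^ℚ suc n = b * (b ^ℚ n)

Word : ℕ → Set
Word a = ℕ → Fin a

SameFactor : ∀ {a} → Word a → ℕ → ℕ → ℕ → Set
SameFactor ω n i j = ∀ k → k < n → ω (i + k) ≡ ω (j + k)

{-# OPTIONS --safe #-}
module Submission where

open import Defs
open import Data.Nat using (ℕ; _≤_; _≥_; ∣_-_∣)
open import Data.Product using (∃; ∃-syntax; _×_)
open import Data.Rational using (ℚ)
open import Relation.Binary.PropositionalEquality using (_≢_)
import Data.Rational as Q

import Algebra.Properties.CommutativeMonoid.Sum
open import Data.Bool using (if_then_else_)
open import Data.Fin using (Fin; zero; suc; _≟_)
open import Data.Integer using (+_)
import Data.Integer as ℤ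
import Data.Integer.Properties as ℤₚ
open import Data.Maybe using (Maybe; just; nothing)
open import Data.Nat using (zero; suc; _+_; _<_; s≤s)
import Data.Nat as ℕ
import Data.Nat.Properties as ℕₚ
open import Data.Product using (_,_; proj₁; proj₂)
open import Data.Rational using (mkℚ; 0ℚ; 1ℚ)
import Data.Rational.Properties as Qₚ
open import Data.Rational.Solver using (module +-*-Solver)
open import Data.Rational.Unnormalised using (mkℚᵘ; *≡*)
import Data.Rational.Unnormalised as U
import Data.Rational.Unnormalised.Properties as ℚᵘₚ
open import Data.Sum using (inj₁; inj₂)
open import Function using (_∘_)
open import Relation.Binary.Definitions using (tri<; tri≈; tri>)
open import Relation.Binary.PropositionalEquality
  using (_≡_; refl; sym; trans; cong; cong₂; subst; subst₂)
open import Relation.Nullary using (Dec; yes; no; does; contradiction)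

module Sum = Algebra.Properties.CommutativeMonoid.Sum Qₚ.+-0-commutativeMonoid
open Sum using (sum)
open +-*-Solver using (solve; _:=_; con) renaming (_:+_ to _⊕_; _:*_ to _⊗_; _:-_ to _⊖_)

-- Fix b < m < a and c = 1 / m, and write ω letter by letter. Let L d be a length at which the
-- distance d + 1 is forbidden. Give every pending repetition at distance d + 1 that still lacks
-- r of its L d letters the weight c ^ r; a completed one would weigh 1. Each pending repetition
-- is continued by exactly one letter, so on average over the next letter the total weight is
-- multiplied by m / a < 1, while newly started repetitions add at most the sum of all c ^ L d.
-- That sum is bounded by a tail of the geometric series of b * c < 1, which is at most 1 - m / a
-- once N is large; so the next letter can always be chosen to keep the total weight below 1.

-- Order and arithmetic of the rationals, and the embedding of the naturals.

0≤1 : 0ℚ Q.≤ 1ℚ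
0≤1 = Qₚ.nonNegative⁻¹ 1ℚ

*-nonNeg : ∀ {p q} → 0ℚ Q.≤ p → 0ℚ Q.≤ q → 0ℚ Q.≤ p Q.* q
*-nonNeg {p} {q} 0≤p 0≤q = Qₚ.nonNegative⁻¹ (p Q.* q)
  {{Qₚ.nonNeg*nonNeg⇒nonNeg p {{Q.nonNegative 0≤p}} q {{Q.nonNegative 0≤q}}}}

+-nonNeg : ∀ {p q} → 0ℚ Q.≤ p → 0ℚ Q.≤ q → 0ℚ Q.≤ p Q.+ q
+-nonNeg = Qₚ.+-mono-≤

*-pos : ∀ {p q} → 0ℚ Q.< p → 0ℚ Q.< q → 0ℚ Q.< p Q.* q
*-pos {p} {q} 0<p 0<q = Qₚ.positive⁻¹ (p Q.* q)
  {{Qₚ.pos*pos⇒pos p {{Q.positive 0<p}} q {{Q.positive 0<q}}}}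

*-monoˡ : ∀ {r p q} → 0ℚ Q.≤ r → p Q.≤ q → r Q.* p Q.≤ r Q.* q
*-monoˡ {r} 0≤r = Qₚ.*-monoˡ-≤-nonNeg r {{Q.nonNegative 0≤r}}

*-monoʳ : ∀ {r p q} → 0ℚ Q.≤ r → p Q.≤ q → p Q.* r Q.≤ q Q.* r
*-monoʳ {r} 0≤r = Qₚ.*-monoʳ-≤-nonNeg r {{Q.nonNegative 0≤r}}

≤-slack : ∀ {p q} r → 0ℚ Q.≤ r → p Q.+ r ≡ q → p Q.≤ q
≤-slack {p} r 0≤r p+r≡q =
  subst (p Q.≤_) p+r≡q (subst (Q._≤ p Q.+ r) (Qₚ.+-identityʳ p) (Qₚ.+-monoʳ-≤ p 0≤r))

+-cancelʳ-≤ : ∀ r {p q} → p Q.+ r Q.≤ q Q.+ r → p Q.≤ q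
+-cancelʳ-≤ r {p} {q} p+r≤q+r with p Q.≤? q
... | yes p≤q = p≤q
... | no p≰q = contradiction (Qₚ.<-≤-trans (Qₚ.+-monoˡ-< r (Qₚ.≰⇒> p≰q)) p+r≤q+r) (Qₚ.<-irrefl refl)

p<q⇒0<q-p : ∀ {p q} → p Q.< q → 0ℚ Q.< q Q.- p
p<q⇒0<q-p {p} {q} p<q = subst (Q._< q Q.- p) (Qₚ.+-inverseʳ p) (Qₚ.+-monoˡ-< (Q.- p) p<q)

reciprocal : ∀ {p} → 0ℚ Q.< p → ∃[ r ] (0ℚ Q.< r × r Q.* p ≡ 1ℚ)
reciprocal {p} 0<p = (Q.1/ p) , Qₚ.positive⁻¹ (Q.1/ p) {{Qₚ.1/pos⇒pos p}} , Qₚ.*-inverseˡ p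
  where instance
    p-pos : Q.Positive p
    p-pos = Q.positive 0<p
    p-nonZero : Q.NonZero p
    p-nonZero = Qₚ.pos⇒nonZero p

ℕ→ℚ-+ : ∀ m n → ℕ→ℚ (m + n) ≡ ℕ→ℚ m Q.+ ℕ→ℚ n
ℕ→ℚ-+ m n = Qₚ.toℚᵘ-injective (begin
  Q.toℚᵘ (ℕ→ℚ (m + n))                         ≈⟨ Qₚ.toℚᵘ-fromℚᵘ (mkℚᵘ (+ (m + n)) 0) ⟩
  mkℚᵘ (+ (m + n)) 0                            ≈⟨ *≡* (cong (ℤ._* + 1) (sym (cong₂ ℤ._+_ (ℤₚ.*-identityʳ (+ m)) (ℤₚ.*-identityʳ (+ n))))) ⟩
  mkℚᵘ (+ m) 0 U.+ mkℚᵘ (+ n) 0                ≈⟨ ℚᵘₚ.+-cong (Qₚ.toℚᵘ-fromℚᵘ (mkℚᵘ (+ m) 0)) (Qₚ.toℚᵘ-fromℚᵘ (mkℚᵘ (+ n) 0)) ⟨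
  Q.toℚᵘ (ℕ→ℚ m) U.+ Q.toℚᵘ (ℕ→ℚ n)           ≈⟨ Qₚ.toℚᵘ-homo-+ (ℕ→ℚ m) (ℕ→ℚ n) ⟨
  Q.toℚᵘ (ℕ→ℚ m Q.+ ℕ→ℚ n)                     ∎)
  where
  open import Relation.Binary.Reasoning.Setoid ℚᵘₚ.≃-setoid

ℕ→ℚ-nonNeg : ∀ n → 0ℚ Q.≤ ℕ→ℚ n
ℕ→ℚ-nonNeg n = Qₚ.nonNegative⁻¹ (ℕ→ℚ n) {{Qₚ.normalize-nonNeg n 1}}

ℕ→ℚ-suc : ∀ n → ℕ→ℚ (suc n) ≡ 1ℚ Q.+ ℕ→ℚ n
ℕ→ℚ-suc = ℕ→ℚ-+ 1

archimedean : ∀ {q} → 0ℚ Q.< q → ∃[ n ] 1ℚ Q.≤ ℕ→ℚ n Q.* q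
archimedean {mkℚ (+ zero) _ _} 0<q = contradiction (Q.positive 0<q) (λ ())
archimedean {mkℚ ℤ.-[1+ _ ] _ _} 0<q = contradiction (Q.positive 0<q) (λ ())
-- The denominator is a witness: multiplying by it leaves the numerator, which is at least 1.
archimedean {q@(mkℚ (+ suc k) d _)} 0<q = suc d , Qₚ.toℚᵘ-cancel-≤ (begin
  mkℚᵘ (+ 1) 0                             ≤⟨ U.*≤* (ℤ.+≤+ 1+d≤) ⟩
  mkℚᵘ (+ suc d) 0 U.* mkℚᵘ (+ suc k) d    ≃⟨ ℚᵘₚ.*-congʳ {mkℚᵘ (+ suc k) d} (Qₚ.toℚᵘ-fromℚᵘ (mkℚᵘ (+ suc d) 0)) ⟨
  Q.toℚᵘ (ℕ→ℚ (suc d)) U.* Q.toℚᵘ q        ≃⟨ Qₚ.toℚᵘ-homo-* (ℕ→ℚ (suc d)) q ⟨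
  Q.toℚᵘ (ℕ→ℚ (suc d) Q.* q)               ∎)
  where
  open ℚᵘₚ.≤-Reasoning
  1+d≤ : 1 ℕ.* (1 ℕ.* suc d) ≤ suc d ℕ.* suc k ℕ.* 1
  1+d≤ = subst₂ _≤_ (sym (trans (ℕₚ.*-identityˡ (1 ℕ.* suc d)) (ℕₚ.*-identityˡ (suc d))))
    (sym (ℕₚ.*-identityʳ (suc d ℕ.* suc k))) (ℕₚ.m≤m*n (suc d) (suc k))

-- Powers and their decay.

^ℚ-nonNeg : ∀ {p} n → 0ℚ Q.≤ p → 0ℚ Q.≤ p ^ℚ n
^ℚ-nonNeg zero 0≤p = 0≤1
^ℚ-nonNeg (suc n) 0≤p = *-nonNeg 0≤p (^ℚ-nonNeg n 0≤p)

^ℚ-monoˡ-≤ : ∀ {p q} n → 0ℚ Q.≤ p → p Q.≤ q → p ^ℚ n Q.≤ q ^ℚ n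
^ℚ-monoˡ-≤ zero 0≤p p≤q = Qₚ.≤-refl
^ℚ-monoˡ-≤ (suc n) 0≤p p≤q = Qₚ.≤-trans (*-monoˡ 0≤p (^ℚ-monoˡ-≤ n 0≤p p≤q))
  (*-monoʳ (^ℚ-nonNeg n (Qₚ.≤-trans 0≤p p≤q)) p≤q)

^ℚ-distrib-* : ∀ p q n → (p Q.* q) ^ℚ n ≡ p ^ℚ n Q.* q ^ℚ n
^ℚ-distrib-* p q zero = refl
^ℚ-distrib-* p q (suc n) = trans (cong (p Q.* q Q.*_) (^ℚ-distrib-* p q n))
  (solve 4 (λ p q x y → (p ⊗ q) ⊗ (x ⊗ y) := (p ⊗ x) ⊗ (q ⊗ y)) refl p q (p ^ℚ n) (q ^ℚ n))

1^ℚ : ∀ n → 1ℚ ^ℚ n ≡ 1ℚ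
1^ℚ zero = refl
1^ℚ (suc n) = trans (Qₚ.*-identityˡ _) (1^ℚ n)

module _ {u : ℚ} (0≤u : 0ℚ Q.≤ u) (u<1 : u Q.< 1ℚ) where
  private
    δ = 1ℚ Q.- u
    0<δ = p<q⇒0<q-p u<1

  -- A division-free form of Bernoulli's inequality. The left side decreases with `n`: each step
  -- loses exactly the nonnegative term `square`.
  bernoulli : ∀ n → u ^ℚ n Q.* (1ℚ Q.+ ℕ→ℚ n Q.* δ) Q.≤ 1ℚ
  bernoulli zero = Qₚ.≤-reflexive (solve 1 (λ x → con 1ℚ ⊗ (con 1ℚ ⊕ con 0ℚ ⊗ x) := con 1ℚ) refl δ)
  bernoulli (suc n) = begin
    u Q.* v Q.* (1ℚ Q.+ ℕ→ℚ (suc n) Q.* δ)  ≡⟨ cong (λ z → u Q.* v Q.* (1ℚ Q.+ z Q.* δ)) (ℕ→ℚ-suc n) ⟩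
    u Q.* v Q.* (1ℚ Q.+ (1ℚ Q.+ k) Q.* δ)   ≤⟨ ≤-slack square 0≤square (solve 3 (λ u v k →
      u ⊗ v ⊗ (con 1ℚ ⊕ (con 1ℚ ⊕ k) ⊗ (con 1ℚ ⊖ u)) ⊕ v ⊗ ((con 1ℚ ⊕ k) ⊗ ((con 1ℚ ⊖ u) ⊗ (con 1ℚ ⊖ u)))
      := v ⊗ (con 1ℚ ⊕ k ⊗ (con 1ℚ ⊖ u))) refl u v k) ⟩
    v Q.* (1ℚ Q.+ k Q.* δ)                   ≤⟨ bernoulli n ⟩
    1ℚ                                       ∎
    where
    open Qₚ.≤-Reasoning
    v = u ^ℚ n
    k = ℕ→ℚ n
    0≤δ = Qₚ.<⇒≤ 0<δ
    square = v Q.* ((1ℚ Q.+ k) Q.* (δ Q.* δ))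
    0≤square : 0ℚ Q.≤ square
    0≤square = *-nonNeg {v} (^ℚ-nonNeg n 0≤u)
      (*-nonNeg {1ℚ Q.+ k} (+-nonNeg {1ℚ} 0≤1 (ℕ→ℚ-nonNeg n)) (*-nonNeg {δ} 0≤δ 0≤δ))

  ^ℚ-vanishes : ∀ {ε} → 0ℚ Q.< ε → ∃[ n ] u ^ℚ n Q.≤ ε
  ^ℚ-vanishes {ε} 0<ε with archimedean (*-pos 0<δ 0<ε)
  ... | n , 1≤nδε = n , (begin
    v                                  ≡⟨ Qₚ.*-identityʳ v ⟨
    v Q.* 1ℚ                           ≤⟨ *-monoˡ 0≤v 1≤nδε ⟩
    v Q.* (k Q.* (δ Q.* ε))            ≤⟨ ≤-slack (v Q.* ε) (*-nonNeg {v} 0≤v 0≤ε) (solve 4 (λ v k d e →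
      v ⊗ (k ⊗ (d ⊗ e)) ⊕ v ⊗ e := v ⊗ (con 1ℚ ⊕ k ⊗ d) ⊗ e) refl v k δ ε) ⟩
    v Q.* (1ℚ Q.+ k Q.* δ) Q.* ε       ≤⟨ *-monoʳ 0≤ε (bernoulli n) ⟩
    1ℚ Q.* ε                           ≡⟨ Qₚ.*-identityˡ ε ⟩
    ε                                  ∎)
    where
    open Qₚ.≤-Reasoning
    v = u ^ℚ n
    k = ℕ→ℚ n
    0≤v = ^ℚ-nonNeg n 0≤u
    0≤ε = Qₚ.<⇒≤ 0<ε

-- Averaging and finite sums.

pigeonhole : ∀ {a} (f : Fin a → ℚ) q → sum f Q.< ℕ→ℚ a Q.* q → ∃[ x ] f x Q.< q
pigeonhole {zero} f q Σ<0 = contradiction (subst (0ℚ Q.<_) (Qₚ.*-zeroˡ q) Σ<0) (Qₚ.<-irrefl {0ℚ} refl)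
pigeonhole {suc a} f q Σ<aq with f zero Q.<? q
... | yes fx<q = zero , fx<q
... | no fx≮q = let x , fx<q = pigeonhole (f ∘ suc) q rest< in suc x , fx<q
  where
  open Qₚ.≤-Reasoning
  aq≡ : ℕ→ℚ (suc a) Q.* q ≡ q Q.+ ℕ→ℚ a Q.* q
  aq≡ = trans (cong (Q._* q) (ℕ→ℚ-suc a))
    (solve 2 (λ k q → (con 1ℚ ⊕ k) ⊗ q := q ⊕ k ⊗ q) refl (ℕ→ℚ a) q)
  rest< : sum (f ∘ suc) Q.< ℕ→ℚ a Q.* q
  rest< = Qₚ.≰⇒> λ aq≤rest → Qₚ.<-irrefl {sum f} refl (Qₚ.<-≤-trans {sum f} (subst (sum f Q.<_) aq≡ Σ<aq)
    (Qₚ.+-mono-≤ {q} {f zero} {ℕ→ℚ a Q.* q} {sum (f ∘ suc)} (Qₚ.≮⇒≥ fx≮q) aq≤rest))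

partialSum : (ℕ → ℚ) → ℕ → ℚ
partialSum f zero = 0ℚ
partialSum f (suc n) = partialSum f n Q.+ f n

partialSum-nonNeg : ∀ {f} → (∀ n → 0ℚ Q.≤ f n) → ∀ n → 0ℚ Q.≤ partialSum f n
partialSum-nonNeg 0≤f zero = Qₚ.≤-refl
partialSum-nonNeg 0≤f (suc n) = +-nonNeg (partialSum-nonNeg 0≤f n) (0≤f n)

term≤partialSum : ∀ {f} → (∀ n → 0ℚ Q.≤ f n) → ∀ {k n} → k < n → f k Q.≤ partialSum f n
term≤partialSum {f} 0≤f {k} {suc n} (s≤s k≤n) with ℕₚ.m≤n⇒m<n∨m≡n k≤n
... | inj₁ k<n = subst (Q._≤ partialSum f (suc n)) (Qₚ.+-identityʳ (f k)) (Qₚ.+-mono-≤ (term≤partialSum 0≤f k<n) (0≤f n))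
... | inj₂ refl = subst (Q._≤ partialSum f (suc n)) (Qₚ.+-identityˡ (f n)) (Qₚ.+-monoˡ-≤ (f n) (partialSum-nonNeg 0≤f n))

partialSum-+ : ∀ f g n → partialSum (λ k → f k Q.+ g k) n ≡ partialSum f n Q.+ partialSum g n
partialSum-+ f g zero = refl
partialSum-+ f g (suc n) = trans (cong (Q._+ (f n Q.+ g n)) (partialSum-+ f g n))
  (solve 4 (λ x y z w → (x ⊕ y) ⊕ (z ⊕ w) := (x ⊕ z) ⊕ (y ⊕ w)) refl
    (partialSum f n) (partialSum g n) (f n) (g n))

sum-indicator : ∀ {a} (y : Fin a) v → sum (λ x → if does (y ≟ x) then v else 0ℚ) ≡ v
sum-indicator {suc a} zero v = trans (cong (v Q.+_) (Sum.sum-replicate-zero a)) (Qₚ.+-identityʳ v)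
sum-indicator (suc y) v = trans (Qₚ.+-identityˡ _) (sum-indicator y v)

-- Choosing the letters so that the total weight stays below 1.

-- At distance d + 1, repetitions of L d letters are to be avoided.
module Avoidance {a : ℕ} (L : ℕ → ℕ) {c m ρ : ℚ} (0≤c : 0ℚ Q.≤ c) (0<m : 0ℚ Q.< m)
  (c*m≡1 : c Q.* m ≡ 1ℚ) (a*ρ≡m : ℕ→ℚ a Q.* ρ ≡ m)
  (budget : ∀ t → partialSum (λ d → c ^ℚ L d) t Q.+ ρ Q.≤ 1ℚ) where

  private
    0≤m = Qₚ.<⇒≤ 0<m

  -- The pending repetitions at one distance all expect the same letter `y`, so when `x` is written
  -- they gain the factor `m = 1 / c` or vanish together. `nothing` means that the word does not
  -- reach back that far.
  gain : Maybe (Fin a) → ℚ → Fin a → ℚ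
  gain nothing  v x = 0ℚ
  gain (just y) v x = if does (y ≟ x) then m Q.* v else 0ℚ

  gain-nonNeg : ∀ l {v} x → 0ℚ Q.≤ v → 0ℚ Q.≤ gain l v x
  gain-nonNeg nothing x 0≤v = Qₚ.≤-refl
  gain-nonNeg (just y) x 0≤v with y ≟ x
  ... | yes _ = *-nonNeg 0≤m 0≤v
  ... | no  _ = Qₚ.≤-refl

  gain-hit : ∀ y v → gain (just y) v y ≡ m Q.* v
  gain-hit y v with y ≟ y
  ... | yes _ = refl
  ... | no y≢y = contradiction refl y≢y

  -- At most one letter continues the repetitions at a given distance, so the factor `m` is paid
  -- once for all `a` choices together.
  sum-gain : ∀ l {v} → 0ℚ Q.≤ v → sum (gain l v) Q.≤ m Q.* v
  sum-gain nothing 0≤v = subst (Q._≤ _) (sym (Sum.sum-replicate-zero a)) (*-nonNeg 0≤m 0≤v)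
  sum-gain (just y) 0≤v = Qₚ.≤-reflexive (sum-indicator y _)

  totalGain : (ℕ → Maybe (Fin a)) → (ℕ → ℚ) → ℕ → Fin a → ℚ
  totalGain l w t x = partialSum (λ d → gain (l d) (w d) x) t

  sum-totalGain : ∀ l {w} → (∀ d → 0ℚ Q.≤ w d) → ∀ t → sum (totalGain l w t) Q.≤ m Q.* partialSum w t
  sum-totalGain l 0≤w zero = Qₚ.≤-reflexive (trans (Sum.sum-replicate-zero a) (sym (Qₚ.*-zeroʳ m)))
  sum-totalGain l {w} 0≤w (suc t) = begin
    sum (totalGain l w (suc t))                        ≡⟨ Sum.∑-distrib-+ (totalGain l w t) (gain (l t) (w t)) ⟩
    sum (totalGain l w t) Q.+ sum (gain (l t) (w t))   ≤⟨ Qₚ.+-mono-≤ (sum-totalGain l 0≤w t) (sum-gain (l t) (0≤w t)) ⟩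
    m Q.* partialSum w t Q.+ m Q.* w t                 ≡⟨ Qₚ.*-distribˡ-+ m (partialSum w t) (w t) ⟨
    m Q.* partialSum w (suc t)                         ∎
    where open Qₚ.≤-Reasoning

  -- The state after t letters: letter d is the one written d + 1 steps ago, and weight d adds up
  -- c ^ r over all pending repetitions at distance d + 1, r being the number of letters still missing.
  record Position (t : ℕ) : Set where
    field
      letter        : ℕ → Maybe (Fin a)
      weight        : ℕ → ℚ
      fresh         : ∀ {d} → t ≤ d → letter d ≡ nothing
      weight-nonNeg : ∀ d → 0ℚ Q.≤ weight d
      total<1       : partialSum weight t Q.< 1ℚ

  open Position

  move : ∀ {t} (p : Position t) → ∃[ x ] totalGain (letter p) (weight p) t x Q.< ρ
  move {t} p = pigeonhole (totalGain (letter p) (weight p) t) ρ (begin-strict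
    sum (totalGain (letter p) (weight p) t)  ≤⟨ sum-totalGain (letter p) (weight-nonNeg p) t ⟩
    m Q.* partialSum (weight p) t            <⟨ Qₚ.*-monoʳ-<-pos m {{Q.positive 0<m}} (total<1 p) ⟩
    m Q.* 1ℚ                                 ≡⟨ Qₚ.*-identityʳ m ⟩
    m                                        ≡⟨ a*ρ≡m ⟨
    ℕ→ℚ a Q.* ρ                              ∎)
    where open Qₚ.≤-Reasoning

  next : ∀ {t} → Position t → Position (suc t)
  next {t} p = record
    { letter        = letter′
    ; weight        = weight′
    ; fresh         = λ { (s≤s t≤d) → fresh p t≤d }
    ; weight-nonNeg = λ d → +-nonNeg (^ℚ-nonNeg (L d) 0≤c) (gain-nonNeg (letter p d) x (weight-nonNeg p d))
    ; total<1       = begin-strict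
        partialSum weight′ (suc t)                  ≡⟨ partialSum-+ base _ (suc t) ⟩
        partialSum base (suc t) Q.+ (g Q.+ gain (letter p t) (weight p t) x)
          -- Distance `t + 1` reaches back before the first letter, so `fresh` makes its gain 0 and
          -- only `g`, which `move` keeps below `ρ`, is left.
          ≡⟨ cong (λ l → partialSum base (suc t) Q.+ (g Q.+ gain l (weight p t) x)) (fresh p ℕₚ.≤-refl) ⟩
        partialSum base (suc t) Q.+ (g Q.+ 0ℚ)      ≡⟨ cong (partialSum base (suc t) Q.+_) (Qₚ.+-identityʳ g) ⟩
        partialSum base (suc t) Q.+ g               <⟨ Qₚ.+-monoʳ-< (partialSum base (suc t)) (proj₂ (move p)) ⟩
        partialSum base (suc t) Q.+ ρ               ≤⟨ budget (suc t) ⟩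
        1ℚ                                          ∎
    }
    where
    open Qₚ.≤-Reasoning
    x = proj₁ (move p)
    base : ℕ → ℚ
    base d = c ^ℚ L d
    letter′ : ℕ → Maybe (Fin a)
    letter′ zero    = just x
    letter′ (suc d) = letter p d
    -- `base d` accounts for the repetition that begins at the next letter, with all `L d` of its
    -- letters still missing.
    weight′ : ℕ → ℚ
    weight′ d = base d Q.+ gain (letter p d) (weight p d) x
    g = totalGain (letter p) (weight p) t x

  position : ∀ t → Position t
  position zero = record
    { letter        = λ _ → nothing
    ; weight        = λ _ → 0ℚ
    ; fresh         = λ _ → refl
    ; weight-nonNeg = λ _ → Qₚ.≤-refl
    ; total<1       = Qₚ.positive⁻¹ 1ℚ
    }
  position (suc t) = next (position t)

  word : Word a
  word t = proj₁ (move (position t))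

  letter-word : ∀ d i → letter (position (suc d + i)) d ≡ just (word i)
  letter-word zero    i = refl
  letter-word (suc d) i = letter-word d i

  weight-base : ∀ t d → c ^ℚ L d Q.≤ weight (position (suc t)) d
  weight-base t d = ≤-slack (gain (letter p d) (weight p d) (word t))
    (gain-nonNeg (letter p d) (word t) (weight-nonNeg p d)) refl
    where p = position t

  weight-hit : ∀ t d → letter (position t) d ≡ just (word t) →
    m Q.* weight (position t) d Q.≤ weight (position (suc t)) d
  weight-hit t d hit = ≤-slack (c ^ℚ L d) (^ℚ-nonNeg (L d) 0≤c)
    (trans (Qₚ.+-comm (m Q.* weight p d) (c ^ℚ L d)) (cong (c ^ℚ L d Q.+_)
      (sym (trans (cong (λ l → gain l (weight p d) (word t)) hit) (gain-hit (word t) (weight p d))))))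
    where p = position t

  -- Only the repetition that starts at `suc d + i` is followed: it enters with weight `c ^ L d`,
  -- and each matching letter multiplies the weight by `m`. The other repetitions at this distance
  -- can only add to it.
  weight-growth : ∀ {d i n} → SameFactor word n i (suc d + i) → ∀ k → k ≤ n →
    c ^ℚ L d Q.* m ^ℚ k Q.≤ weight (position (k + (suc d + i))) d
  weight-growth {d} {i} same zero _ =
    subst (Q._≤ weight (position (suc d + i)) d) (sym (Qₚ.*-identityʳ (c ^ℚ L d))) (weight-base (d + i) d)
  weight-growth {d} {i} {n} same (suc k) k<n = Qₚ.≤-trans (Qₚ.≤-trans
    (Qₚ.≤-reflexive (solve 3 (λ x m y → x ⊗ (m ⊗ y) := m ⊗ (x ⊗ y)) refl (c ^ℚ L d) m (m ^ℚ k)))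
    (*-monoˡ 0≤m (weight-growth {d} {i} {n} same k (ℕₚ.<⇒≤ k<n))))
    (weight-hit t d hit)
    where
    t = k + (suc d + i)
    t≡ : t ≡ suc d + (i + k)
    t≡ = trans (ℕₚ.+-comm k (suc d + i)) (ℕₚ.+-assoc (suc d) i k)
    hit : letter (position t) d ≡ just (word t)
    hit = trans (trans (cong (λ s → letter (position s) d) t≡) (letter-word d (i + k)))
      (cong just (trans (same k k<n) (cong word (ℕₚ.+-comm (suc d + i) k))))

  -- A match of `L d` letters would give this distance weight at least `c ^ L d * m ^ L d = 1`,
  -- against `total<1`.
  word-avoids : ∀ {d i n} → SameFactor word n i (suc d + i) → n < L d
  word-avoids {d} {i} {n} same = ℕₚ.≰⇒> λ L≤n → Qₚ.<-irrefl {1ℚ} refl (begin-strict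
    1ℚ                                  ≡⟨ 1^ℚ (L d) ⟨
    1ℚ ^ℚ L d                           ≡⟨ cong (_^ℚ L d) c*m≡1 ⟨
    (c Q.* m) ^ℚ L d                    ≡⟨ ^ℚ-distrib-* c m (L d) ⟩
    c ^ℚ L d Q.* m ^ℚ L d               ≤⟨ weight-growth {d} {i} {n} same (L d) L≤n ⟩
    weight (position t) d               ≤⟨ term≤partialSum (weight-nonNeg (position t)) d<t ⟩
    partialSum (weight (position t)) t  <⟨ total<1 (position t) ⟩
    1ℚ                                  ∎)
    where
    open Qₚ.≤-Reasoning
    t = L d + (suc d + i)
    -- `total<1` covers only the indices below `t`; the later copy starts at `suc d + i`, which
    -- already exceeds `d`.
    d<t : d < t
    d<t = ℕₚ.≤-trans (ℕₚ.m≤m+n (suc d) i) (ℕₚ.m≤n+m (suc d + i) (L d))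

-- Forbidden length for each distance.

raiseUnless : {P : Set} → Dec P → ℕ → ℕ
raiseUnless (yes _) n = n
raiseUnless (no  _) n = suc n

-- A lower bound on the n ≥ N with d + 1 < b ^ n. It need not be the least such n: rising by at most
-- one at each d avoids a search.
threshold : ℚ → ℕ → ℕ → ℕ
threshold b N zero = N
threshold b N (suc d) =
  raiseUnless (ℕ→ℚ (2 + d) Q.<? b ^ℚ threshold b N d) (threshold b N d)

ℕ→ℚ-<-suc : ∀ n → ℕ→ℚ n Q.< ℕ→ℚ (suc n)
ℕ→ℚ-<-suc n = subst₂ Q._<_ (Qₚ.+-identityˡ (ℕ→ℚ n)) (sym (ℕ→ℚ-suc n))
  (Qₚ.+-monoˡ-< (ℕ→ℚ n) (Qₚ.positive⁻¹ 1ℚ))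

threshold≤ : ∀ {b N n} → N ≤ n → ∀ d → ℕ→ℚ (suc d) Q.< b ^ℚ n → threshold b N d ≤ n
threshold≤ N≤n zero d< = N≤n
threshold≤ {b} {N} {n} N≤n (suc d) d<
  with ℕ→ℚ (2 + d) Q.<? b ^ℚ threshold b N d | threshold≤ {b} N≤n d (Qₚ.<-trans (ℕ→ℚ-<-suc (suc d)) d<)
... | yes _ | ih = ih
-- A threshold already equal to `n` would have passed the test, so it is still below `n` and may
-- rise by one.
... | no d≮ | ih = ℕₚ.≤∧≢⇒< ih λ { refl → d≮ d< }

-- Comparison of the sum of all `c ^ L d` with the remainder of a geometric series.

module _ {b c u : ℚ} (0≤c : 0ℚ Q.≤ c) (c≤u : c Q.≤ u) (c*b≡u : c Q.* b ≡ u)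
  (tail : ℕ → ℚ) (tail-nonNeg : ∀ n → 0ℚ Q.≤ tail n)
  (tail-step : ∀ n → tail n ≡ u ^ℚ n Q.+ tail (suc n)) (N : ℕ) where

  private
    L = threshold b N
    S = partialSum (λ d → c ^ℚ L d)

  c^n+tail≤ : ∀ n → c ^ℚ n Q.+ tail (suc n) Q.≤ tail n
  c^n+tail≤ n = subst (c ^ℚ n Q.+ tail (suc n) Q.≤_) (sym (tail-step n))
    (Qₚ.+-monoˡ-≤ (tail (suc n)) (^ℚ-monoˡ-≤ n 0≤c c≤u))

  -- The terms of S with L d = n number at most b ^ n, so that they contribute at most u ^ n;
  -- the second invariant counts them.
  threshold-invariant : ∀ d →
    S d Q.+ (c ^ℚ L d Q.+ tail (suc (L d))) Q.≤ tail N ×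
    S d Q.+ tail (L d) Q.≤ tail N Q.+ ℕ→ℚ d Q.* c ^ℚ L d
  threshold-invariant zero =
    subst (Q._≤ tail N) (sym (Qₚ.+-identityˡ _)) (c^n+tail≤ N) ,
    Qₚ.≤-reflexive (solve 2 (λ x y → con 0ℚ ⊕ x := x ⊕ con 0ℚ ⊗ y) refl (tail N) (c ^ℚ N))
  threshold-invariant (suc d)
    with ℕ→ℚ (2 + d) Q.<? b ^ℚ L d | threshold-invariant d
  -- The level `n` stays. Beyond what lower levels used, `count` allows for `d` terms `y`; with two
  -- more they total at most `b ^ n * y = u ^ n`, the share of level `n` in `tail n`. Adding
  -- `k * y + u ^ n` to both sides avoids subtraction.
  ... | yes d< | _ , count = +-cancelʳ-≤ (k Q.* y Q.+ u ^ℚ n) (begin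
      s Q.+ y Q.+ (y Q.+ tail (suc n)) Q.+ (k Q.* y Q.+ u ^ℚ n)
        ≡⟨ solve 5 (λ s y t k v → s ⊕ y ⊕ (y ⊕ t) ⊕ (k ⊗ y ⊕ v) := s ⊕ (v ⊕ t) ⊕ (con 1ℚ ⊕ (con 1ℚ ⊕ k)) ⊗ y)
             refl s y (tail (suc n)) k (u ^ℚ n) ⟩
      s Q.+ (u ^ℚ n Q.+ tail (suc n)) Q.+ (1ℚ Q.+ (1ℚ Q.+ k)) Q.* y
        ≡⟨ cong₂ (λ x z → s Q.+ x Q.+ z Q.* y) (tail-step n) 2+d ⟨
      s Q.+ tail n Q.+ ℕ→ℚ (2 + d) Q.* y
        ≤⟨ Qₚ.+-mono-≤ count (*-monoʳ 0≤y (Qₚ.<⇒≤ d<)) ⟩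
      tail N Q.+ k Q.* y Q.+ b ^ℚ n Q.* y
        ≡⟨ cong (tail N Q.+ k Q.* y Q.+_) b^n*c^n ⟩
      tail N Q.+ k Q.* y Q.+ u ^ℚ n
        ≡⟨ Qₚ.+-assoc (tail N) (k Q.* y) (u ^ℚ n) ⟩
      tail N Q.+ (k Q.* y Q.+ u ^ℚ n) ∎) , (begin
      s Q.+ y Q.+ tail n                     ≡⟨ solve 3 (λ s y t → s ⊕ y ⊕ t := s ⊕ t ⊕ y) refl s y (tail n) ⟩
      s Q.+ tail n Q.+ y                     ≤⟨ Qₚ.+-monoˡ-≤ y count ⟩
      tail N Q.+ k Q.* y Q.+ y               ≡⟨ solve 3 (λ t k y → t ⊕ k ⊗ y ⊕ y := t ⊕ (con 1ℚ ⊕ k) ⊗ y) refl (tail N) k y ⟩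
      tail N Q.+ (1ℚ Q.+ k) Q.* y            ≡⟨ cong (λ z → tail N Q.+ z Q.* y) (ℕ→ℚ-suc d) ⟨
      tail N Q.+ ℕ→ℚ (suc d) Q.* y           ∎)
    where
    open Qₚ.≤-Reasoning
    n = L d
    s = S d
    y = c ^ℚ n
    k = ℕ→ℚ d
    0≤y = ^ℚ-nonNeg n 0≤c
    2+d : ℕ→ℚ (2 + d) ≡ 1ℚ Q.+ (1ℚ Q.+ k)
    2+d = trans (ℕ→ℚ-suc (suc d)) (cong (1ℚ Q.+_) (ℕ→ℚ-suc d))
    b^n*c^n : b ^ℚ n Q.* y ≡ u ^ℚ n
    b^n*c^n = trans (Qₚ.*-comm (b ^ℚ n) y) (trans (sym (^ℚ-distrib-* c b n)) (cong (_^ℚ n) c*b≡u))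
  -- A new level opens: `room` leaves `tail (suc n)` free, and the first term `c ^ suc n` fits there
  -- because `c ≤ u`.
  ... | no _ | room , _ = (begin
      s Q.+ y Q.+ (c ^ℚ suc n Q.+ tail (suc (suc n)))  ≤⟨ Qₚ.+-monoʳ-≤ (s Q.+ y) (c^n+tail≤ (suc n)) ⟩
      s Q.+ y Q.+ tail (suc n)                         ≤⟨ room′ ⟩
      tail N                                           ∎) , (begin
      s Q.+ y Q.+ tail (suc n)                         ≤⟨ room′ ⟩
      tail N                                           ≤⟨ ≤-slack _ (*-nonNeg {ℕ→ℚ (suc d)} (ℕ→ℚ-nonNeg (suc d)) (^ℚ-nonNeg (suc n) 0≤c)) refl ⟩
      tail N Q.+ ℕ→ℚ (suc d) Q.* c ^ℚ suc n            ∎)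
    where
    open Qₚ.≤-Reasoning
    n = L d
    s = S d
    y = c ^ℚ n
    room′ : s Q.+ y Q.+ tail (suc n) Q.≤ tail N
    room′ = subst (Q._≤ tail N) (sym (Qₚ.+-assoc s y (tail (suc n)))) room

  partialSum-threshold : ∀ d → S d Q.≤ tail N
  partialSum-threshold d = Qₚ.≤-trans
    (≤-slack _ (+-nonNeg (^ℚ-nonNeg (L d) 0≤c) (tail-nonNeg (suc (L d)))) refl)
    (proj₁ (threshold-invariant d))

-- Reduction of arbitrary pairs of occurrences to ordered ones.

SeparatedBy : ∀ {a} → ℚ → Word a → ℕ → ℕ → ℕ → Set
SeparatedBy q ω n i j = SameFactor ω n i j → q Q.≤ ℕ→ℚ ∣ i - j ∣

separated-< : ∀ {a q n} (ω : Word a) → (∀ i d → SameFactor ω n i (suc d + i) → q Q.≤ ℕ→ℚ (suc d)) →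
  ∀ {i j} → i < j → SeparatedBy q ω n i j
separated-< {q = q} {n} ω sep {i} i<j same with ℕₚ.m≤n⇒∃[o]m+o≡n i<j
... | d , refl = subst (λ k → q Q.≤ ℕ→ℚ k) (sym distance)
  (sep i d (subst (SameFactor ω n i) (cong suc (ℕₚ.+-comm i d)) same))
  where
  distance : ∣ i - (suc i + d) ∣ ≡ suc d
  distance = trans (cong (∣ i -_∣) (sym (ℕₚ.+-suc i d))) (ℕₚ.∣m-m+n∣≡n i (suc d))

separated-≢ : ∀ {a q n} (ω : Word a) → (∀ i d → SameFactor ω n i (suc d + i) → q Q.≤ ℕ→ℚ (suc d)) →
  ∀ i j → i ≢ j → SeparatedBy q ω n i j
separated-≢ {q = q} ω sep i j i≢j same with ℕₚ.<-cmp i j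
... | tri< i<j _ _ = separated-< ω sep i<j same
... | tri≈ _ i≡j _ = contradiction i≡j i≢j
... | tri> _ _ j<i = subst (λ k → q Q.≤ ℕ→ℚ k) (ℕₚ.∣-∣-comm j i)
  (separated-< ω sep j<i (λ k k<n → sym (same k k<n)))

-- Choice of the constants and assembly.

module Construction {a : ℕ} {b c m u ρ κ : ℚ} (0≤c : 0ℚ Q.≤ c) (c≤u : c Q.≤ u) (c*b≡u : c Q.* b ≡ u)
  (0<m : 0ℚ Q.< m) (c*m≡1 : c Q.* m ≡ 1ℚ) (a*ρ≡m : ℕ→ℚ a Q.* ρ ≡ m)
  (0≤κ : 0ℚ Q.≤ κ) (κ*[1-u]≡1 : κ Q.* (1ℚ Q.- u) ≡ 1ℚ)
  (N : ℕ) (small : u ^ℚ N Q.≤ (1ℚ Q.- ρ) Q.* (1ℚ Q.- u)) where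

  open Qₚ.≤-Reasoning

  private
    0≤u = Qₚ.≤-trans 0≤c c≤u

  -- As κ = 1 / (1 - u), this is the sum of u ^ k over all k ≥ n.
  tail : ℕ → ℚ
  tail n = u ^ℚ n Q.* κ
  tail-nonNeg : ∀ n → 0ℚ Q.≤ tail n
  tail-nonNeg n = *-nonNeg {u ^ℚ n} (^ℚ-nonNeg n 0≤u) 0≤κ
  tail-step : ∀ n → tail n ≡ u ^ℚ n Q.+ tail (suc n)
  tail-step n = begin-equality
    v Q.* κ                                            ≡⟨ solve 3 (λ u v k → v ⊗ k := v ⊗ (k ⊗ (con 1ℚ ⊖ u)) ⊕ u ⊗ v ⊗ k) refl u v κ ⟩
    v Q.* (κ Q.* (1ℚ Q.- u)) Q.+ tail (suc n)          ≡⟨ cong (λ x → v Q.* x Q.+ tail (suc n)) κ*[1-u]≡1 ⟩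
    v Q.* 1ℚ Q.+ tail (suc n)                          ≡⟨ cong (Q._+ tail (suc n)) (Qₚ.*-identityʳ v) ⟩
    v Q.+ tail (suc n)                                 ∎
    where v = u ^ℚ n
  -- The choice of `N` fits the whole geometric remainder into the room left by the averaging factor
  -- `ρ = m / a`.
  tail-N : tail N Q.≤ 1ℚ Q.- ρ
  tail-N = begin
    u ^ℚ N Q.* κ                              ≤⟨ *-monoʳ 0≤κ small ⟩
    (1ℚ Q.- ρ) Q.* (1ℚ Q.- u) Q.* κ           ≡⟨ solve 3 (λ x y k → x ⊗ y ⊗ k := x ⊗ (k ⊗ y)) refl (1ℚ Q.- ρ) (1ℚ Q.- u) κ ⟩
    (1ℚ Q.- ρ) Q.* (κ Q.* (1ℚ Q.- u))         ≡⟨ cong ((1ℚ Q.- ρ) Q.*_) κ*[1-u]≡1 ⟩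
    (1ℚ Q.- ρ) Q.* 1ℚ                         ≡⟨ Qₚ.*-identityʳ (1ℚ Q.- ρ) ⟩
    1ℚ Q.- ρ                                  ∎

  L = threshold b N
  budget : ∀ t → partialSum (λ d → c ^ℚ L d) t Q.+ ρ Q.≤ 1ℚ
  budget t = begin
    partialSum (λ d → c ^ℚ L d) t Q.+ ρ
      ≤⟨ Qₚ.+-monoˡ-≤ ρ (Qₚ.≤-trans (partialSum-threshold 0≤c c≤u c*b≡u tail tail-nonNeg tail-step N t) tail-N) ⟩
    (1ℚ Q.- ρ) Q.+ ρ                     ≡⟨ solve 1 (λ x → (con 1ℚ ⊖ x) ⊕ x := con 1ℚ) refl ρ ⟩
    1ℚ                                   ∎

  open Avoidance {a} L {c} {m} {ρ} 0≤c 0<m c*m≡1 a*ρ≡m budget public using (word; word-avoids)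

  -- A distance `d + 1 < b ^ n` has threshold at most `n`, whereas a repetition of `n` letters at
  -- that distance forces `n < L d`.
  word-separated : ∀ n → n ≥ N → ∀ i j → i ≢ j → SameFactor word n i j → b ^ℚ n Q.≤ ℕ→ℚ ∣ i - j ∣
  word-separated n N≤n = separated-≢ {q = b ^ℚ n} {n} word λ i d same → Qₚ.≮⇒≥ λ close →
    ℕₚ.<⇒≱ (word-avoids {d} {i} {n} same) (threshold≤ N≤n d close)

separatedWord : ∀ {a b c m u ρ} → 0ℚ Q.≤ c → c Q.≤ u → c Q.* b ≡ u → u Q.< 1ℚ →
  0ℚ Q.< m → c Q.* m ≡ 1ℚ → ℕ→ℚ a Q.* ρ ≡ m → ρ Q.< 1ℚ →
  ∃[ N ] ∃[ ω ] ((n : ℕ) → n ≥ N → (i j : ℕ) → i ≢ j →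
    SameFactor {a} ω n i j → b ^ℚ n Q.≤ ℕ→ℚ ∣ i - j ∣)
separatedWord {a} {b} {c} {m} {u} {ρ} 0≤c c≤u c*b≡u u<1 0<m c*m≡1 a*ρ≡m ρ<1 =
  build (reciprocal 0<1-u) (^ℚ-vanishes (Qₚ.≤-trans 0≤c c≤u) u<1 (*-pos (p<q⇒0<q-p ρ<1) 0<1-u))
  where
  0<1-u = p<q⇒0<q-p u<1
  build : ∃[ κ ] (0ℚ Q.< κ × κ Q.* (1ℚ Q.- u) ≡ 1ℚ) →
    ∃[ N ] u ^ℚ N Q.≤ (1ℚ Q.- ρ) Q.* (1ℚ Q.- u) → _
  build (κ , 0<κ , κ*[1-u]≡1) (N , small) = N , word , word-separated
    where
    open Construction {a} {b} {c} {m} {u} {ρ} {κ} 0≤c c≤u c*b≡u 0<m c*m≡1 a*ρ≡m (Qₚ.<⇒≤ 0<κ) κ*[1-u]≡1 N small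

theorem3 : (a : ℕ) → a ≥ 2 → (b : ℚ) → Q.1ℚ Q.< b → b Q.< ℕ→ℚ a →
    ∃[ N ] ∃[ ω ] ((n : ℕ) → n ≥ N → (i j : ℕ) → i ≢ j →
    SameFactor {a} ω n i j → b ^ℚ n Q.≤ ℕ→ℚ ∣ i - j ∣)
theorem3 a _ b 1<b b<a = choose (Qₚ.<-dense b<a)
  where
  -- With `c = 1 / m`, `u = c * b` and `ρ = m / a`, the bound `b < m` gives `u < 1`, `m < a` gives
  -- `ρ < 1`, and `1 < b` gives `c ≤ u`.
  choose : ∃[ m ] (b Q.< m × m Q.< ℕ→ℚ a) → _
  choose (m , b<m , m<a) = build (reciprocal 0<m) (reciprocal (Qₚ.<-trans 0<m m<a))
    where
    0<m = Qₚ.<-trans (Qₚ.<-trans (Qₚ.positive⁻¹ 1ℚ) 1<b) b<m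
    build : ∃[ c ] (0ℚ Q.< c × c Q.* m ≡ 1ℚ) → ∃[ α ] (0ℚ Q.< α × α Q.* ℕ→ℚ a ≡ 1ℚ) → _
    build (c , 0<c , c*m≡1) (α , 0<α , α*a≡1) =
      separatedWord (Qₚ.<⇒≤ 0<c) c≤c*b refl c*b<1 0<m c*m≡1 a*[α*m]≡m α*m<1
      where
      c≤c*b : c Q.≤ c Q.* b
      c≤c*b = subst (Q._≤ c Q.* b) (Qₚ.*-identityʳ c) (*-monoˡ (Qₚ.<⇒≤ 0<c) (Qₚ.<⇒≤ 1<b))
      c*b<1 : c Q.* b Q.< 1ℚ
      c*b<1 = subst (c Q.* b Q.<_) c*m≡1 (Qₚ.*-monoʳ-<-pos c {{Q.positive 0<c}} b<m)
      α*m<1 : α Q.* m Q.< 1ℚ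
      α*m<1 = subst (α Q.* m Q.<_) α*a≡1 (Qₚ.*-monoʳ-<-pos α {{Q.positive 0<α}} m<a)
      a*[α*m]≡m : ℕ→ℚ a Q.* (α Q.* m) ≡ m
      a*[α*m]≡m = trans (solve 3 (λ x y z → x ⊗ (y ⊗ z) := (y ⊗ x) ⊗ z) refl (ℕ→ℚ a) α m)
        (trans (cong (Q._* m) α*a≡1) (Qₚ.*-identityˡ m))
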